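{- Let $a$ and $c$ be positive integers and let $b$ and $d$ be any integers such that $ad\ne bc$. Then for any positive integer $k$, the set of positive integers $n$ for which \[ \phi\big(a(n+1)+b\big) > \phi\big(c(n+1)+d\big),\quad \phi\big(a(n+2)+b\big) > \phi\big(c(n+2)+d\big),\quad \dots,\quad \phi\big(a(n+k)+b\big) > \phi\big(c(n+k)+d\big) \] all hold has positive lower density.
   Context: $\phi$ denotes the Euler phi-function on positive integers. The lower density of a set $S$ of positive integers is $\liminf_{x\to\infty} \frac1x\#\{n\in S: n\le x\}$. Only those $n$ for which all arguments of $\phi$ are positive are considered; this excludes only finitely many $n$ and does not affect lower density. -}

module Defs where

open import Data.Fin.Base using (Fin; toℕ)
open import Data.Fin.Properties using (all?)
open import Data.Integer.Base using (ℤ; +_; 0ℤ; ∣_∣; _+_; _*_; _<_)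
import Data.Integer.Properties as ℤ
open import Data.List.Base using (filter; length; map; upTo)
open import Data.Nat.Base as ℕ using (ℕ; suc)
import Data.Nat.Properties as ℕ
open import Data.Nat.Coprimality using (coprime?)
open import Data.Product.Base using (_×_; ∃-syntax)
open import Data.Rational.Base as ℚ using (ℚ; 0ℚ)
open import Level using (0ℓ)
open import Relation.Nullary.Decidable using (Dec; _×-dec_)
open import Relation.Unary using (Pred; Decidable; _∈_)

-- The number of n in P with 1 ≤ n ≤ x.
count : {P : Pred ℕ 0ℓ} → Decidable P → ℕ → ℕ
count P? x = length (filter P? (map suc (upTo x)))

φ : ℕ → ℕ
φ n = count (λ m → coprime? m n) n

-- The limit inferior of a rational sequence, as the lower cut of rationals
-- strictly below it: q < lim inf f iff some r > q eventually bounds f from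
-- below.
liminf : (ℕ → ℚ) → Pred ℚ 0ℓ
liminf f q = ∃[ r ] (q ℚ.< r × ∃[ N ] (∀ n → N ℕ.≤ n → r ℚ.≤ f n))

-- The ratios #{n ∈ P : n ≤ x} / x are indexed from x = 1, so that the
-- denominator is nonzero.  Integral x suffices: the count depends only on the
-- integer part of x, and x / ⌊x⌋ → 1.
lowerDensity : (P : Pred ℕ 0ℓ) → Decidable P → Pred ℚ 0ℓ
lowerDensity P P? = liminf (λ x → (+ count P? (suc x)) ℚ./ suc x)

HasPositiveLowerDensity : (P : Pred ℕ 0ℓ) → Decidable P → Set
HasPositiveLowerDensity P P? = 0ℚ ∈ lowerDensity P P?

-- φ(u) > φ(v) for integers u and v; it is only meaningful, and only counted
-- as holding, when both arguments are positive.
_φ>_ : ℤ → ℤ → Set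
u φ> v = 0ℤ < u × 0ℤ < v × φ ∣ u ∣ ℕ.> φ ∣ v ∣

_φ>?_ : ∀ u v → Dec (u φ> v)
u φ>? v = (0ℤ ℤ.<? u) ×-dec (0ℤ ℤ.<? v) ×-dec (φ ∣ v ∣ ℕ.<? φ ∣ u ∣)

-- The index i : Fin k stands for the shift i + 1 ∈ {1, …, k}.
φ-Run : (a b c d : ℤ) (k : ℕ) → Pred ℕ 0ℓ
φ-Run a b c d k n = (i : Fin k) →
  let m = + (n ℕ.+ suc (toℕ i)) in (a * m + b) φ> (c * m + d)

φ-Run? : ∀ a b c d k → Decidable (φ-Run a b c d k)
φ-Run? a b c d k n = all? λ i →
  let m = + (n ℕ.+ suc (toℕ i)) in (a * m + b) φ>? (c * m + d)

{-# OPTIONS --safe #-}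
module Submission where

-- Put u(n, s) = a (n + s) + b and v(n, s) = c (n + s) + d.  After a translation
-- of n all coefficients are positive natural numbers.  There is an arithmetic
-- progression of n whose long initial segments have at least half of their
-- terms in the set in question: along it every v(n, s) is divisible by a number
-- Q with φ(Q) / Q tiny, whereas φ(u) / u is mostly bounded below for u(n, s).
-- No prime numbers are needed.
--
-- * φ-*-≤.  If Q divides v then φ(v) / v ≤ φ(Q) / Q.
--
-- * small-φ-ratio.  For all W and K some Q coprime to W has φ(Q) K < Q.  Take
--   Q to be the product of the numbers e = 1 + jW for j < 2ˢ.  The multiples
--   m e with m coprime to Q have gcd e with Q, so those for different e are
--   disjoint.  Counting them up to Q² gives φ(Q) / Q · Σ 1 / e ≤ 1, in which the
--   sum is unbounded as s grows.
--
-- * φ-lower.  A common divisor of u and a number m ≡ 1 modulo P is coprime to P.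
--   Counting these m up to P u, of which at most P φ(u) are coprime to u, gives
--   P φ(u) / u ≥ 1 - Σ 1 / e over the divisors e > 1 of u that are coprime to P.
--
-- * Average.few-bad.  Let u run through T terms of a progression with
--   difference A, and suppose that every such e exceeds Y and is coprime to A.
--   Each e then divides at most T / e + 1 of the terms, so the mean of Σ 1 / e
--   is at most 2 / Y + O(1 / T), and u ≤ 2 P φ(u) for all but about a
--   proportion 4 / Y of the terms.
--
-- The order in which the Q's are chosen matters, because u(n, s) can be
-- proportional to v(n, s′) for another shift s′, so that forcing a factor into
-- v(n, s′) also forces it into u(n, s).  Now c u(n, s) - a v(n, s′) equals the
-- constant a c (s - s′) + (b c - a d), which vanishes for at most one value of
-- s - s′, and that value is not 0.  Its sign is known, hence treating the
-- shifts in descending order when b c > a d, and in ascending order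
-- otherwise, ensures that the constant is nonzero whenever s′ is treated at
-- the same time as s or later.  The Q of s′ is chosen coprime to these
-- constants, hence to the earlier u(n, s), so the lower bound for φ(u) / u
-- involves a modulus P made of earlier Q's only, and the Q of s can be chosen
-- with φ(Q) / Q small compared with 1 / P.

open import Defs

module _ where
  open import Data.Empty using (⊥-elim)
  import Data.Integer.Base as ℤ
  import Data.Integer.Properties as ℤ
  open import Data.List.Base using (filter; length; applyUpTo)
  open import Data.List.Properties using (map-applyUpTo)
  open import Data.Bool.Base using (if_then_else_)
  open import Data.Nat.Base using (ℕ; zero; suc; pred; _+_; _*_; _∸_; _^_; _≤_; _<_; z≤n; s≤s; z<s; s<s; ∣_-_∣; NonZero; >-nonZero)
  open import Data.Nat.Coprimality as Coprimality using (Coprime; coprime?; coprime-divisor)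
  open import Data.Nat.Divisibility
  open import Data.Nat.DivMod using (_/_; _%_; m/n*n≡m; m/n*n≤m; m*n/n≡m; /-mono-≤; m≡m%n+[m/n]*n; m%n≤n)
  open import Data.Nat.GCD using (gcd; gcd[m,n]∣m; gcd[m,n]∣n; c*gcd[m,n]≡gcd[cm,cn]; module Bézout)
  open import Data.Nat.Properties
  open import Data.Nat.Tactic.RingSolver using (solve-∀)
  open import Data.Product.Base using (_×_; _,_; proj₁; proj₂; ∃-syntax)
  import Data.Rational.Base as ℚ
  import Data.Rational.Properties as ℚ
  import Data.Rational.Unnormalised.Base as ℚᵘ
  import Data.Rational.Unnormalised.Properties as ℚᵘ
  open import Data.Sum.Base using (inj₁; inj₂)
  open import Function.Base using (_∘_)
  open import Level using (0ℓ)
  open import Relation.Binary.Definitions using (Tri; tri<; tri≈; tri>)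
  open import Relation.Binary.PropositionalEquality using (_≡_; _≢_; refl; sym; trans; cong; cong₂; subst; subst₂; module ≡-Reasoning)
  open import Relation.Nullary.Decidable using (Dec; yes; no; does; _×-dec_; dec-true; dec-false)
  open import Relation.Nullary.Negation using (¬_; contradiction)
  open import Relation.Unary using (Pred; Decidable)

  -- Finite sums

  -- The sum of f i over i < n.
  ∑ : ℕ → (ℕ → ℕ) → ℕ
  ∑ zero    f = 0
  ∑ (suc n) f = f 0 + ∑ n (λ i → f (suc i))

  ∑-mono : ∀ n {f g} → (∀ i → i < n → f i ≤ g i) → ∑ n f ≤ ∑ n g
  ∑-mono zero    f≤g = z≤n
  ∑-mono (suc n) f≤g = +-mono-≤ (f≤g 0 z<s) (∑-mono n λ i i<n → f≤g (suc i) (s<s i<n))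

  ∑-cong : ∀ n {f g} → (∀ i → i < n → f i ≡ g i) → ∑ n f ≡ ∑ n g
  ∑-cong n f≡g = ≤-antisym (∑-mono n λ i i<n → ≤-reflexive (f≡g i i<n))
                           (∑-mono n λ i i<n → ≤-reflexive (sym (f≡g i i<n)))

  ∑-const : ∀ n c → ∑ n (λ _ → c) ≡ n * c
  ∑-const zero    c = refl
  ∑-const (suc n) c = cong (c +_) (∑-const n c)

  ∑-distrib-+ : ∀ n f g → ∑ n (λ i → f i + g i) ≡ ∑ n f + ∑ n g
  ∑-distrib-+ zero    f g = refl
  ∑-distrib-+ (suc n) f g =
    trans (cong (f 0 + g 0 +_) (∑-distrib-+ n (f ∘ suc) (g ∘ suc)))
          (interchange (f 0) (g 0) (∑ n (f ∘ suc)) (∑ n (g ∘ suc)))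
    where
    interchange : ∀ w x y z → w + x + (y + z) ≡ w + y + (x + z)
    interchange = solve-∀

  *-distribˡ-∑ : ∀ c n f → c * ∑ n f ≡ ∑ n (λ i → c * f i)
  *-distribˡ-∑ c zero    f = *-zeroʳ c
  *-distribˡ-∑ c (suc n) f =
    trans (*-distribˡ-+ c (f 0) _) (cong (c * f 0 +_) (*-distribˡ-∑ c n (f ∘ suc)))

  *-distribʳ-∑ : ∀ c n f → ∑ n f * c ≡ ∑ n (λ i → f i * c)
  *-distribʳ-∑ c n f = trans (*-comm (∑ n f) c)
    (trans (*-distribˡ-∑ c n f) (∑-cong n λ i _ → *-comm c (f i)))

  ∑-swap : ∀ m n (f : ℕ → ℕ → ℕ) → ∑ m (λ i → ∑ n (f i)) ≡ ∑ n (λ j → ∑ m (λ i → f i j))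
  ∑-swap zero    n f = sym (trans (∑-const n 0) (*-zeroʳ n))
  ∑-swap (suc m) n f = trans (cong (∑ n (f 0) +_) (∑-swap m n (f ∘ suc)))
                             (sym (∑-distrib-+ n (f 0) _))

  ∑-++ : ∀ m n f → ∑ (m + n) f ≡ ∑ m f + ∑ n (λ i → f (m + i))
  ∑-++ zero    n f = refl
  ∑-++ (suc m) n f = trans (cong (f 0 +_) (∑-++ m n (f ∘ suc))) (sym (+-assoc (f 0) _ _))

  ∑-block : ∀ m n f → ∑ (m * n) f ≡ ∑ m (λ i → ∑ n (λ j → f (i * n + j)))
  ∑-block zero    n f = refl
  ∑-block (suc m) n f = trans (∑-++ n (m * n) f) (cong (∑ n f +_)
    (trans (∑-block m n (f ∘ (n +_)))
           (∑-cong m λ i _ → ∑-cong n λ j _ → cong f (sym (+-assoc n (i * n) j)))))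

  term≤∑ : ∀ n f {i} → i < n → f i ≤ ∑ n f
  term≤∑ (suc n) f {zero}  _   = m≤m+n (f 0) _
  term≤∑ (suc n) f {suc i} i<n = ≤-trans (term≤∑ n (f ∘ suc) (≤-pred i<n)) (m≤n+m _ (f 0))

  ∑-mono-length : ∀ {m n} f → m ≤ n → ∑ m f ≤ ∑ n f
  ∑-mono-length {m} {n} f m≤n = begin
    ∑ m f                                ≤⟨ m≤m+n (∑ m f) _ ⟩
    ∑ m f + ∑ (n ∸ m) (λ i → f (m + i))  ≡⟨ ∑-++ m (n ∸ m) f ⟨
    ∑ (m + (n ∸ m)) f                    ≡⟨ cong (λ l → ∑ l f) (m+[n∸m]≡n m≤n) ⟩
    ∑ n f                                ∎
    where open ≤-Reasoning

  -- Sampling f once in every block of length e.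
  ∑-sample : ∀ w e f {s} → s < e → ∑ w (λ i → f (i * e + s)) ≤ ∑ (w * e) f
  ∑-sample w e f s<e = ≤-trans
    (∑-mono w λ i _ → term≤∑ e (λ j → f (i * e + j)) s<e)
    (≤-reflexive (sym (∑-block w e f)))

  -- If h drops by at least g i at every step, then ∑ g is at most the total drop.
  ∑-telescope : ∀ n (g h : ℕ → ℕ) → (∀ i → i < n → g i + h (suc i) ≤ h i) →
                ∑ n g + h n ≤ h 0
  ∑-telescope zero    g h step = ≤-refl
  ∑-telescope (suc n) g h step = begin
    g 0 + ∑ n (g ∘ suc) + h (suc n)    ≡⟨ +-assoc (g 0) _ _ ⟩
    g 0 + (∑ n (g ∘ suc) + h (suc n))  ≤⟨ +-monoʳ-≤ (g 0) (∑-telescope n (g ∘ suc) (h ∘ suc)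
                                            λ i i<n → step (suc i) (s<s i<n)) ⟩
    g 0 + h 1                          ≤⟨ step 0 z<s ⟩
    h 0                                ∎
    where open ≤-Reasoning

  -- The Iverson bracket: 1 if the proposition holds and 0 otherwise.
  [_] : {P : Set} → Dec P → ℕ
  [ p? ] = if does p? then 1 else 0

  module _ {P : Set} where

    []-true : (p? : Dec P) → P → [ p? ] ≡ 1
    []-true p? p rewrite dec-true p? p = refl

    []-false : (p? : Dec P) → ¬ P → [ p? ] ≡ 0
    []-false p? ¬p rewrite dec-false p? ¬p = refl

  []-mono : {P Q : Set} (p? : Dec P) (q? : Dec Q) → (P → Q) → [ p? ] ≤ [ q? ]
  []-mono (yes p) q? f = ≤-reflexive (sym ([]-true q? (f p)))
  []-mono (no _)  q? f = z≤n

  []-cong : {P Q : Set} (p? : Dec P) (q? : Dec Q) → (P → Q) → (Q → P) → [ p? ] ≡ [ q? ]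
  []-cong p? q? f g = ≤-antisym ([]-mono p? q? f) ([]-mono q? p? g)

  -- A property with at most one solution below n has count at most 1.
  ∑-unique : ∀ n {P : ℕ → Set} (P? : ∀ i → Dec (P i)) →
             (∀ i j → i < n → j < n → P i → P j → i ≡ j) → ∑ n (λ i → [ P? i ]) ≤ 1
  ∑-unique zero    P? unique = z≤n
  ∑-unique (suc n) P? unique with P? 0
  ... | yes p₀ = s≤s (≤-reflexive (trans (∑-cong n rest) (trans (∑-const n 0) (*-zeroʳ n))))
    where
    rest : ∀ i → i < n → [ P? (suc i) ] ≡ 0
    rest i i<n = []-false (P? (suc i)) λ p → case-0≡suc (unique 0 (suc i) z<s (s<s i<n) p₀ p)
      where
      case-0≡suc : 0 ≢ suc i
      case-0≡suc ()
  ... | no _ = ∑-unique n (P? ∘ suc) λ i j i<n j<n p q →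
    suc-injective (unique (suc i) (suc j) (s<s i<n) (s<s j<n) p q)

  count≡∑ : {P : Pred ℕ 0ℓ} (P? : Decidable P) (x : ℕ) → count P? x ≡ ∑ x (λ i → [ P? (suc i) ])
  count≡∑ P? x = trans (cong (length ∘ filter P?) (map-applyUpTo (λ i → i) suc x)) (go x suc)
    where
    go : ∀ n f → length (filter P? (applyUpTo f n)) ≡ ∑ n (λ i → [ P? (f i) ])
    go zero    f = refl
    go (suc n) f with P? (f 0)
    ... | yes _ = cong suc (go n (f ∘ suc))
    ... | no  _ = go n (f ∘ suc)

  -- Coprimality and the upper bound for φ

  coprime-∣ : ∀ {m m′ n n′} → m′ ∣ m → n′ ∣ n → Coprime m n → Coprime m′ n′
  coprime-∣ m′∣m n′∣n coprime (d∣m′ , d∣n′) = coprime (∣-trans d∣m′ m′∣m , ∣-trans d∣n′ n′∣n)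

  coprime-* : ∀ {e m n} → Coprime e m → Coprime e n → Coprime e (m * n)
  coprime-* {e} {m} {n} e⊥m e⊥n {d} (d∣e , d∣mn) = e⊥n (d∣e , coprime-divisor d⊥m d∣mn)
    where
    d⊥m : Coprime d m
    d⊥m (c∣d , c∣m) = e⊥m (∣-trans c∣d d∣e , c∣m)

  φ≡∑ : ∀ n → φ n ≡ ∑ n (λ i → [ coprime? (suc i) n ])
  φ≡∑ n = count≡∑ (λ m → coprime? m n) n

  -- Each of k consecutive periods of length n contributes φ n, as coprimality to
  -- n is periodic modulo n.
  ∑-coprime : ∀ k n → ∑ (k * n) (λ i → [ coprime? (suc i) n ]) ≡ k * φ n
  ∑-coprime k n = begin
    ∑ (k * n) (λ i → [ coprime? (suc i) n ])                     ≡⟨ ∑-block k n _ ⟩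
    ∑ k (λ i → ∑ n (λ j → [ coprime? (suc (i * n + j)) n ]))     ≡⟨ ∑-cong k (λ i _ → ∑-cong n λ j _ → periodic i j) ⟩
    ∑ k (λ i → ∑ n (λ j → [ coprime? (suc j) n ]))               ≡⟨ ∑-cong k (λ _ _ → φ≡∑ n) ⟨
    ∑ k (λ i → φ n)                                              ≡⟨ ∑-const k (φ n) ⟩
    k * φ n                                                      ∎
    where
    open ≡-Reasoning
    periodic : ∀ i j → [ coprime? (suc (i * n + j)) n ] ≡ [ coprime? (suc j) n ]
    periodic i j rewrite sym (+-suc (i * n) j) = []-cong (coprime? (i * n + suc j) n) (coprime? (suc j) n)
      (λ c (d∣j , d∣n) → c (∣m∣n⇒∣m+n (∣n⇒∣m*n i d∣n) d∣j , d∣n))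
      (λ c (d∣m , d∣n) → c (∣m+n∣m⇒∣n d∣m (∣n⇒∣m*n i d∣n) , d∣n))

  -- What is coprime to q t is coprime to q, and q t consists of t periods of
  -- length q.
  φ-*-≤ : ∀ q t → φ (q * t) ≤ t * φ q
  φ-*-≤ q t = begin
    φ (q * t)                                          ≡⟨ φ≡∑ (q * t) ⟩
    ∑ (q * t) (λ i → [ coprime? (suc i) (q * t) ])     ≤⟨ ∑-mono (q * t) (λ i _ →
      []-mono (coprime? (suc i) (q * t)) (coprime? (suc i) q) (coprime-∣ ∣-refl (m∣m*n t))) ⟩
    ∑ (q * t) (λ i → [ coprime? (suc i) q ])           ≡⟨ cong (λ l → ∑ l (λ i → [ coprime? (suc i) q ])) (*-comm q t) ⟩
    ∑ (t * q) (λ i → [ coprime? (suc i) q ])           ≡⟨ ∑-coprime t q ⟩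
    t * φ q                                            ∎
    where open ≤-Reasoning

  -- Multiples of e in an arithmetic progression

  -- An arithmetic progression whose difference A is coprime to e meets the
  -- multiples of e at most once in e consecutive terms.
  progression-block : ∀ {e A} .{{_ : NonZero e}} → Coprime e A → ∀ B →
                      ∑ e (λ j → [ e ∣? (A * j + B) ]) ≤ 1
  progression-block {e} {A} e⊥A B = ∑-unique e (λ j → e ∣? (A * j + B)) unique
    where
    -- e divides A (j - i), hence j - i, which is less than e.
    wlog : ∀ i j → i ≤ j → j < e → e ∣ A * i + B → e ∣ A * j + B → i ≡ j
    wlog i j i≤j j<e e∣i e∣j with j ∸ i in eq
    ... | zero  = ≤-antisym i≤j (m∸n≡0⇒m≤n eq)
    ... | suc k = contradiction (∣⇒≤ e∣k) (<⇒≱ (≤-<-trans (subst (_≤ j) eq (m∸n≤m j i)) j<e))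
      where
      split : A * j + B ≡ A * i + B + A * suc k
      split = trans (cong (λ l → A * l + B) (trans (sym (m+[n∸m]≡n i≤j)) (cong (i +_) eq)))
                    (rearrange A i (suc k) B)
        where
        rearrange : ∀ A i l B → A * (i + l) + B ≡ A * i + B + A * l
        rearrange = solve-∀
      e∣k : e ∣ suc k
      e∣k = coprime-divisor e⊥A (∣m+n∣m⇒∣n (subst (e ∣_) split e∣j) e∣i)

    unique : ∀ i j → i < e → j < e → e ∣ A * i + B → e ∣ A * j + B → i ≡ j
    unique i j i<e j<e e∣i e∣j with ≤-total i j
    ... | inj₁ i≤j = wlog i j i≤j j<e e∣i e∣j
    ... | inj₂ j≤i = sym (wlog j i j≤i i<e e∣j e∣i)

  progression-count : ∀ {e A} .{{_ : NonZero e}} → Coprime e A → ∀ B w →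
                      ∑ (w * e) (λ j → [ e ∣? (A * j + B) ]) ≤ w
  progression-count {e} {A} e⊥A B w = begin
    ∑ (w * e) (λ j → [ e ∣? (A * j + B) ])                      ≡⟨ ∑-block w e _ ⟩
    ∑ w (λ i → ∑ e (λ j → [ e ∣? (A * (i * e + j) + B) ]))      ≤⟨ ∑-mono w (λ i _ → block i) ⟩
    ∑ w (λ i → 1)                                               ≡⟨ ∑-const w 1 ⟩
    w * 1                                                       ≡⟨ *-identityʳ w ⟩
    w                                                           ∎
    where
    open ≤-Reasoning
    rearrange : ∀ A l j B → A * (l + j) + B ≡ A * j + (A * l + B)
    rearrange = solve-∀
    block : ∀ i → ∑ e (λ j → [ e ∣? (A * (i * e + j) + B) ]) ≤ 1
    block i = ≤-trans
      (≤-reflexive (∑-cong e λ j _ → cong (λ l → [ e ∣? l ]) (rearrange A (i * e) j B)))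
      (progression-block e⊥A (A * (i * e) + B))

  -- Numbers with a small ratio φ(Q) / Q

  -- The product of f i over i < n.
  ∏ : ℕ → (ℕ → ℕ) → ℕ
  ∏ zero    f = 1
  ∏ (suc n) f = f 0 * ∏ n (λ i → f (suc i))

  ∣∏ : ∀ n f {i} → i < n → f i ∣ ∏ n f
  ∣∏ (suc n) f {zero}  _   = m∣m*n (∏ n (f ∘ suc))
  ∣∏ (suc n) f {suc i} i<n = ∣n⇒∣m*n (f 0) (∣∏ n (f ∘ suc) (≤-pred i<n))

  0<∏ : ∀ n {f} → (∀ i → i < n → 0 < f i) → 0 < ∏ n f
  0<∏ zero    0<f = z<s
  0<∏ (suc n) 0<f = *-mono-≤ (0<f 0 z<s) (0<∏ n λ i i<n → 0<f (suc i) (s<s i<n))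

  coprime-∏ : ∀ {e} n {f} → (∀ i → i < n → Coprime e (f i)) → Coprime e (∏ n f)
  coprime-∏ zero    e⊥f (_ , d∣1) = ∣1⇒≡1 d∣1
  coprime-∏ (suc n) e⊥f = coprime-* (e⊥f 0 z<s) (coprime-∏ n λ i i<n → e⊥f (suc i) (s<s i<n))

  gcd-multiple : ∀ {e m Q} → e ∣ Q → Coprime m Q → gcd (m * e) Q ≡ e
  gcd-multiple {e} {m} {Q} (divides q refl) m⊥Q = begin
    gcd (m * e) (q * e)  ≡⟨ cong₂ gcd (*-comm m e) (*-comm q e) ⟩
    gcd (e * m) (e * q)  ≡⟨ c*gcd[m,n]≡gcd[cm,cn] e m q ⟨
    e * gcd m q          ≡⟨ cong (e *_) (Coprimality.coprime⇒gcd≡1 (coprime-∣ ∣-refl (m∣m*n e) m⊥Q)) ⟩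
    e * 1                ≡⟨ *-identityʳ e ⟩
    e                    ∎
    where open ≡-Reasoning

  -- For pairwise distinct divisors e₀, e₁, … of Q the sum of the reciprocals of
  -- the e j is at most Q / φ Q.  Here q j stands for Q / e j.
  φ-∑-divisors : ∀ Q n (e q : ℕ → ℕ) → (∀ j → j < n → 0 < e j) → (∀ j → j < n → q j * e j ≡ Q) →
                 (∀ i j → e i ≡ e j → i ≡ j) → φ Q * ∑ n q ≤ Q * Q
  φ-∑-divisors Q n e q 0<e qe≡Q e-injective = begin
    φ Q * ∑ n q                                              ≡⟨ *-distribˡ-∑ (φ Q) n q ⟩
    ∑ n (λ j → φ Q * q j)                                    ≤⟨ ∑-mono n class ⟩
    ∑ n (λ j → ∑ (Q * Q) (λ x → [ gcd (suc x) Q ≟ e j ]))    ≡⟨ ∑-swap n (Q * Q) _ ⟩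
    ∑ (Q * Q) (λ x → ∑ n (λ j → [ gcd (suc x) Q ≟ e j ]))    ≤⟨ ∑-mono (Q * Q) (λ x _ →
        ∑-unique n (λ j → gcd (suc x) Q ≟ e j) (λ i j _ _ p r → e-injective i j (trans (sym p) r))) ⟩
    ∑ (Q * Q) (λ x → 1)                                      ≡⟨ ∑-const (Q * Q) 1 ⟩
    Q * Q * 1                                                ≡⟨ *-identityʳ (Q * Q) ⟩
    Q * Q                                                    ∎
    where
    open ≤-Reasoning
    length-eq : ∀ q Q e → q * Q * e ≡ q * e * Q
    length-eq = solve-∀
    -- The multiples m * e j with m coprime to Q all have gcd e j with Q.  Those
    -- up to Q * Q are given by the q j periods of m up to q j * Q.
    class : ∀ j → j < n → φ Q * q j ≤ ∑ (Q * Q) (λ x → [ gcd (suc x) Q ≟ e j ])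
    class j j<n with e j | 0<e j j<n | qe≡Q j j<n
    ... | suc e′ | _ | eq = begin
      φ Q * q j                                              ≡⟨ *-comm (φ Q) (q j) ⟩
      q j * φ Q                                              ≡⟨ ∑-coprime (q j) Q ⟨
      ∑ (q j * Q) (λ i → [ coprime? (suc i) Q ])             ≤⟨ ∑-mono (q j * Q) (λ i _ →
          []-mono (coprime? (suc i) Q) (gcd (suc (i * suc e′ + e′)) Q ≟ suc e′) (in-class i)) ⟩
      ∑ (q j * Q) (λ i → [ gcd (suc (i * suc e′ + e′)) Q ≟ suc e′ ])
                                                             ≤⟨ ∑-sample (q j * Q) (suc e′) (λ x → [ gcd (suc x) Q ≟ suc e′ ]) ≤-refl ⟩
      ∑ (q j * Q * suc e′) (λ x → [ gcd (suc x) Q ≟ suc e′ ])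
                                                             ≡⟨ cong (λ l → ∑ l (λ x → [ gcd (suc x) Q ≟ suc e′ ]))
                                                                  (trans (length-eq (q j) Q (suc e′)) (cong (_* Q) eq)) ⟩
      ∑ (Q * Q) (λ x → [ gcd (suc x) Q ≟ suc e′ ])           ∎
      where
      rearrange : ∀ i e′ → suc (i * suc e′ + e′) ≡ suc i * suc e′
      rearrange = solve-∀
      in-class : ∀ i → Coprime (suc i) Q → gcd (suc (i * suc e′ + e′)) Q ≡ suc e′
      in-class i i⊥Q rewrite rearrange i e′ = gcd-multiple (divides (q j) (sym eq)) i⊥Q

  -- Divergence of the sum of 1 / (1 + jW): every dyadic block 2ˢ ≤ j < 2ˢ⁺¹
  -- contributes at least 1 / 2W.
  harmonic : ∀ {W Q} → 0 < W → ∀ s (q : ℕ → ℕ) → (∀ j → j < 2 ^ s → q j * suc (j * W) ≡ Q) →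
             s * Q ≤ 2 * W * ∑ (2 ^ s) q
  harmonic         0<W zero    q eq = z≤n
  harmonic {W} {Q} 0<W (suc s) q eq = begin
    Q + s * Q                                                ≤⟨ +-mono-≤ block (harmonic 0<W s q λ j j<N → eq j (≤-trans j<N (m≤m+n N _))) ⟩
    2 * W * ∑ N (λ j → q (N + j)) + 2 * W * ∑ N q            ≡⟨ *-distribˡ-+ (2 * W) (∑ N (λ j → q (N + j))) (∑ N q) ⟨
    2 * W * (∑ N (λ j → q (N + j)) + ∑ N q)                  ≡⟨ cong (2 * W *_) (+-comm (∑ N (λ j → q (N + j))) (∑ N q)) ⟩
    2 * W * (∑ N q + ∑ N (λ j → q (N + j)))                  ≡⟨ cong (2 * W *_) (∑-++ N N q) ⟨
    2 * W * ∑ (N + N) q                                      ≡⟨ cong (λ l → 2 * W * ∑ (N + l) q) (+-identityʳ N) ⟨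
    2 * W * ∑ (2 ^ suc s) q                                  ∎
    where
    open ≤-Reasoning
    N = 2 ^ s
    instance
      _ : NonZero N
      _ = m^n≢0 2 s
    rearrange₁ : ∀ N W → (N + N) * W ≡ 2 * W * N
    rearrange₁ = solve-∀
    rearrange₂ : ∀ S W N → S * (2 * W * N) ≡ N * (2 * W * S)
    rearrange₂ = solve-∀
    e≤2WN : ∀ j → j < N → suc ((N + j) * W) ≤ 2 * W * N
    e≤2WN j j<N = begin
      1 + (N + j) * W   ≤⟨ +-monoˡ-≤ ((N + j) * W) 0<W ⟩
      suc (N + j) * W   ≤⟨ *-monoˡ-≤ W (+-monoʳ-< N j<N) ⟩
      (N + N) * W       ≡⟨ rearrange₁ N W ⟩
      2 * W * N         ∎
    block : Q ≤ 2 * W * ∑ N (λ j → q (N + j))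
    block = *-cancelˡ-≤ N (begin
      N * Q                                       ≡⟨ ∑-const N Q ⟨
      ∑ N (λ _ → Q)                               ≤⟨ ∑-mono N (λ j j<N → begin
          Q                              ≡⟨ eq (N + j) (≤-trans (+-monoʳ-< N j<N) (+-monoʳ-≤ N (m≤m+n N 0))) ⟨
          q (N + j) * suc ((N + j) * W)  ≤⟨ *-monoʳ-≤ (q (N + j)) (e≤2WN j j<N) ⟩
          q (N + j) * (2 * W * N)        ∎) ⟩
      ∑ N (λ j → q (N + j) * (2 * W * N))         ≡⟨ *-distribʳ-∑ (2 * W * N) N (λ j → q (N + j)) ⟨
      ∑ N (λ j → q (N + j)) * (2 * W * N)         ≡⟨ rearrange₂ (∑ N (λ j → q (N + j))) W N ⟩
      N * (2 * W * ∑ N (λ j → q (N + j)))         ∎)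

  -- Q is the product of the numbers 1 + jW for j < 2ˢ.  The sum of their
  -- reciprocals is at least s / 2W, which is K + 1.
  small-φ-ratio : ∀ W K → 0 < W → ∃[ Q ] (0 < Q × Coprime Q W × φ Q * K < Q)
  small-φ-ratio W K 0<W = Q , 0<Q , Coprimality.sym (coprime-∏ n λ j _ → W⊥e j) , shave (φ Q) bound
    where
    open ≤-Reasoning
    s = 2 * W * suc K
    n = 2 ^ s
    e : ℕ → ℕ
    e j = suc (j * W)
    Q = ∏ n e
    q : ℕ → ℕ
    q j = Q / e j
    0<Q : 0 < Q
    0<Q = 0<∏ n λ _ _ → z<s
    instance
      _ : NonZero W
      _ = >-nonZero 0<W
      _ : NonZero Q
      _ = >-nonZero 0<Q
    W⊥e : ∀ j → Coprime W (e j)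
    W⊥e j {d} (d∣W , d∣e) = ∣1⇒≡1 (∣m+n∣m⇒∣n (subst (d ∣_) (+-comm 1 (j * W)) d∣e) (∣n⇒∣m*n j d∣W))
    qe≡Q : ∀ j → j < n → q j * e j ≡ Q
    qe≡Q j j<n = m/n*n≡m (∣∏ n e j<n)
    rearrange₁ : ∀ f W K Q → 2 * W * Q * (f * K) ≡ f * (2 * W * K * Q)
    rearrange₁ = solve-∀
    rearrange₂ : ∀ f W S → f * (2 * W * S) ≡ 2 * W * (f * S)
    rearrange₂ = solve-∀
    bound : φ Q * suc K ≤ Q
    bound = *-cancelˡ-≤ (2 * W * Q) {{m*n≢0 (2 * W) Q {{m*n≢0 2 W}}}} (begin
      2 * W * Q * (φ Q * suc K)     ≡⟨ rearrange₁ (φ Q) W (suc K) Q ⟩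
      φ Q * (s * Q)                 ≤⟨ *-monoʳ-≤ (φ Q) (harmonic 0<W s q qe≡Q) ⟩
      φ Q * (2 * W * ∑ n q)         ≡⟨ rearrange₂ (φ Q) W (∑ n q) ⟩
      2 * W * (φ Q * ∑ n q)         ≤⟨ *-monoʳ-≤ (2 * W) (φ-∑-divisors Q n e q (λ _ _ → z<s) qe≡Q
                                         λ i j ei≡ej → *-cancelʳ-≡ i j W (suc-injective ei≡ej)) ⟩
      2 * W * (Q * Q)               ≡⟨ *-assoc (2 * W) Q Q ⟨
      2 * W * Q * Q                 ∎)
    shave : ∀ f → f * suc K ≤ Q → f * K < Q
    shave zero    _     = 0<Q
    shave (suc f) bound = <-≤-trans (*-monoʳ-< (suc f) (n<1+n K)) bound

  -- The lower bound for φ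

  -- A common divisor greater than 1 is presented as a successor suc i.
  ¬coprime⇒common-divisor : ∀ {m n} → 0 < m → ¬ Coprime m n → ∃[ i ] (0 < i × suc i ∣ m × suc i ∣ n)
  ¬coprime⇒common-divisor {m} {n} 0<m ¬coprime with gcd m n in eq | gcd[m,n]∣m m n | gcd[m,n]∣n m n
  ... | zero        | g∣m | _   = contradiction (0∣⇒≡0 g∣m) (>⇒≢ 0<m)
  ... | suc zero    | _   | _   = ⊥-elim (¬coprime (Coprimality.gcd≡1⇒coprime eq))
  ... | suc (suc g) | g∣m | g∣n = suc g , z<s , g∣m , g∣n

  -- e is a divisor of u that is greater than 1 and coprime to P.
  RoughDivisor : ℕ → ℕ → ℕ → Set
  RoughDivisor P u e = 1 < e × e ∣ u × Coprime e P

  -- Opaque, so that brackets of it do not unfold to boolean arithmetic.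
  abstract
    roughDivisor? : ∀ P u e → Dec (RoughDivisor P u e)
    roughDivisor? P u e = (1 <? e) ×-dec (e ∣? u) ×-dec coprime? e P

  -- The inequality P φ(u) ≥ u (1 - Σ 1 / e) over the rough divisors e of u,
  -- multiplied by L to clear denominators: ω i stands for L / (i + 1).  The proof
  -- counts the numbers P j + 1 with j < u.  At most P φ(u) of them are coprime to
  -- u, and at most u / e of them are divisible by a given rough divisor e.
  φ-lower : ∀ {L U} (ω : ℕ → ℕ) → (∀ i → i < U → ω i * suc i ≡ L) →
            ∀ {P u} → 0 < P → 0 < u → u ≤ U →
            L * u ≤ L * (P * φ u) + u * ∑ U (λ i → [ roughDivisor? P u (suc i) ] * ω i)
  φ-lower {L} {U} ω ω-eq {P} {u} 0<P 0<u u≤U = begin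
    L * u                                                    ≡⟨ trans (*-comm L u) (sym (∑-const u L)) ⟩
    ∑ u (λ j → L)                                            ≤⟨ ∑-mono u (λ j _ → pointwise j) ⟩
    ∑ u (λ j → L * c j + ∑ U (λ i → r i * L * h i j))        ≡⟨ ∑-distrib-+ u (λ j → L * c j) _ ⟩
    ∑ u (λ j → L * c j) + ∑ u (λ j → ∑ U (λ i → r i * L * h i j))
      ≡⟨ cong₂ _+_ (sym (*-distribˡ-∑ L u c))
           (trans (∑-swap u U (λ j i → r i * L * h i j))
                  (∑-cong U λ i _ → sym (*-distribˡ-∑ (r i * L) u (h i)))) ⟩
    L * ∑ u c + ∑ U (λ i → r i * L * ∑ u (h i))              ≤⟨ +-mono-≤ (*-monoʳ-≤ L coprime-count) (∑-mono U divisor-count) ⟩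
    L * (P * φ u) + ∑ U (λ i → u * (r i * ω i))              ≡⟨ cong (L * (P * φ u) +_) (sym (*-distribˡ-∑ u U (λ i → r i * ω i))) ⟩
    L * (P * φ u) + u * ∑ U (λ i → r i * ω i)                ∎
    where
    open ≤-Reasoning
    instance
      _ : NonZero u
      _ = >-nonZero 0<u
    r : ℕ → ℕ
    r i = [ roughDivisor? P u (suc i) ]
    c : ℕ → ℕ
    c j = [ coprime? (suc (j * P + 0)) u ]
    h : ℕ → ℕ → ℕ
    h i j = [ suc i ∣? P * j + 1 ]
    m≡ : ∀ j P → suc (j * P + 0) ≡ P * j + 1
    m≡ = solve-∀

    coprime-count : ∑ u c ≤ P * φ u
    coprime-count = begin
      ∑ u c                                              ≤⟨ ∑-sample u P (λ i → [ coprime? (suc i) u ]) 0<P ⟩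
      ∑ (u * P) (λ i → [ coprime? (suc i) u ])           ≡⟨ cong (λ l → ∑ l (λ i → [ coprime? (suc i) u ])) (*-comm u P) ⟩
      ∑ (P * u) (λ i → [ coprime? (suc i) u ])           ≡⟨ ∑-coprime P u ⟩
      P * φ u                                            ∎

    divisor-count : ∀ i → i < U → r i * L * ∑ u (h i) ≤ u * (r i * ω i)
    divisor-count i i<U with roughDivisor? P u (suc i)
    ... | no _ = z≤n
    ... | yes (_ , divides w u≡ , e⊥P) = begin
      (L + 0) * ∑ u (h i)                ≡⟨ cong₂ _*_ (+-identityʳ L) (cong (λ l → ∑ l (h i)) u≡) ⟩
      L * ∑ (w * suc i) (h i)            ≤⟨ *-monoʳ-≤ L (progression-count e⊥P 1 w) ⟩
      L * w                              ≡⟨ cong (_* w) (ω-eq i i<U) ⟨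
      ω i * suc i * w                    ≡⟨ rearrange (ω i) (suc i) w ⟩
      w * suc i * (ω i + 0)              ≡⟨ cong (_* (ω i + 0)) u≡ ⟨
      u * (ω i + 0)                      ∎
      where
      rearrange : ∀ o e w → o * e * w ≡ w * e * (o + 0)
      rearrange = solve-∀

    -- If P j + 1 is not coprime to u, then it shares with u a divisor e > 1,
    -- which is coprime to P because it divides P j + 1.
    pointwise : ∀ j → L ≤ L * c j + ∑ U (λ i → r i * L * h i j)
    pointwise j with coprime? (suc (j * P + 0)) u
    ... | yes m⊥u = ≤-trans (≤-reflexive (sym (trans (cong (L *_) ([]-true (coprime? (suc (j * P + 0)) u) m⊥u)) (*-identityʳ L))))
                            (m≤m+n (L * c j) _)
    ... | no ¬coprime with ¬coprime⇒common-divisor z<s ¬coprime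
    ... | i , 0<i , e∣m , e∣u = begin
      L                                                   ≡⟨ L≡term ⟩
      r i * L * h i j                                     ≤⟨ term≤∑ U (λ i → r i * L * h i j) (≤-trans (∣⇒≤ e∣u) u≤U) ⟩
      ∑ U (λ i → r i * L * h i j)                         ≤⟨ m≤n+m _ (L * c j) ⟩
      L * c j + ∑ U (λ i → r i * L * h i j)               ∎
      where
      e∣Pj+1 : suc i ∣ P * j + 1
      e∣Pj+1 = subst (suc i ∣_) (m≡ j P) e∣m
      e⊥P : Coprime (suc i) P
      e⊥P (d∣e , d∣P) = ∣1⇒≡1 (∣m+n∣m⇒∣n (∣-trans d∣e e∣Pj+1) (∣m⇒∣m*n j d∣P))
      L≡term : L ≡ r i * L * h i j
      L≡term = sym (trans (cong₂ (λ x y → x * L * y)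
          ([]-true (roughDivisor? P u (suc i)) (s<s 0<i , e∣u , e⊥P))
          ([]-true (suc i ∣? P * j + 1) e∣Pj+1))
        (trans (*-identityʳ (L + 0)) (+-identityʳ L)))

  -- The average of the sum over rough divisors

  -- The terms u t = A t + B for t < T, when the divisors e > 1 of the terms that
  -- are coprime to P are larger than y + 1 and coprime to A.
  module Average
    {A B P y : ℕ} (0<A : 0 < A) (0<B : 0 < B) (0<P : 0 < P)
    (rough⇒large : ∀ {e} → 1 < e → Coprime e P → suc y < e)
    (rough⇒⊥A : ∀ {e} t → e ∣ A * t + B → Coprime e P → Coprime e A)
    (T : ℕ) (y<T : y < T)
    where

    u : ℕ → ℕ
    u t = A * t + B

    -- U bounds all the terms, and L is a common multiple of 1, …, U.
    U L : ℕ
    U = (A + B) * T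
    L = ∏ U suc

    -- The weight L / e of e = i + 1.
    ω : ℕ → ℕ
    ω i = L / suc i

    ω-eq : ∀ i → i < U → ω i * suc i ≡ L
    ω-eq i i<U = m/n*n≡m (∣∏ U suc i<U)

    T≤U : T ≤ U
    T≤U = ≤-trans (≤-reflexive (sym (*-identityˡ T))) (*-monoˡ-≤ T (≤-trans 0<A (m≤m+n A B)))

    -- The number of terms that have i + 1 as a rough divisor.
    N : ℕ → ℕ
    N i = ∑ T (λ t → [ roughDivisor? P (u t) (suc i) ])

    N≤ : ∀ i w → T ≤ w * suc i → N i ≤ w
    N≤ i w T≤we with coprime? (suc i) A
    ... | yes e⊥A = begin
      N i                                            ≤⟨ ∑-mono-length (λ t → [ roughDivisor? P (u t) (suc i) ]) T≤we ⟩
      ∑ (w * suc i) (λ t → [ roughDivisor? P (u t) (suc i) ])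
                                                     ≤⟨ ∑-mono (w * suc i) (λ t _ →
                                                          []-mono (roughDivisor? P (u t) (suc i)) (suc i ∣? u t) (λ r → proj₁ (proj₂ r))) ⟩
      ∑ (w * suc i) (λ t → [ suc i ∣? A * t + B ])   ≤⟨ progression-count e⊥A B w ⟩
      w                                              ∎
      where open ≤-Reasoning
    ... | no ¬e⊥A = ≤-trans (≤-reflexive (trans (∑-cong T none) (trans (∑-const T 0) (*-zeroʳ T)))) z≤n
      where
      none : ∀ t → t < T → [ roughDivisor? P (u t) (suc i) ] ≡ 0
      none t _ = []-false (roughDivisor? P (u t) (suc i))
        λ (_ , e∣u , e⊥P) → ¬e⊥A (rough⇒⊥A t e∣u e⊥P)

    N-small : ∀ i → i < suc y → N i ≡ 0
    N-small i i<Y = trans (∑-cong T none) (trans (∑-const T 0) (*-zeroʳ T))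
      where
      none : ∀ t → t < T → [ roughDivisor? P (u t) (suc i) ] ≡ 0
      none t _ = []-false (roughDivisor? P (u t) (suc i))
        λ (1<e , _ , e⊥P) → <⇒≱ (rough⇒large 1<e e⊥P) i<Y

    N-medium : ∀ i → i < T → N i * i ≤ 2 * T
    N-medium i i<T = begin
      N i * i                        ≤⟨ *-mono-≤ (N≤ i (suc (T / suc i)) T≤) (n≤1+n i) ⟩
      suc i + T / suc i * suc i      ≤⟨ +-mono-≤ i<T (m/n*n≤m T (suc i)) ⟩
      T + T                          ≡⟨ cong (T +_) (+-identityʳ T) ⟨
      2 * T                          ∎
      where
      open ≤-Reasoning
      T≤ : T ≤ suc (T / suc i) * suc i
      T≤ = ≤-trans (≤-reflexive (m≡m%n+[m/n]*n T (suc i))) (+-monoˡ-≤ (T / suc i * suc i) (m%n≤n T (suc i)))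

    N-large : ∀ i → T ≤ i → N i ≤ 1
    N-large i T≤i = N≤ i 1 (≤-trans T≤i (≤-trans (n≤1+n i) (≤-reflexive (sym (*-identityˡ (suc i))))))

    -- For y < i < T one has ω i N i ≤ 2 T ω i / i = 2 T (ω (i - 1) - ω i), and the
    -- right-hand side telescopes to at most 2 T ω y = 2 T L / (y + 1).
    medium : suc y * ∑ (T ∸ suc y) (λ j → ω (suc y + j) * N (suc y + j)) ≤ 2 * T * L
    medium = begin
      suc y * ∑ (T ∸ suc y) g        ≤⟨ *-monoʳ-≤ (suc y) (≤-trans (m≤m+n _ (h (T ∸ suc y))) (∑-telescope (T ∸ suc y) g h step)) ⟩
      suc y * h 0                    ≡⟨ cong (λ i → suc y * (2 * T * ω i)) (+-identityʳ y) ⟩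
      suc y * (2 * T * ω y)          ≡⟨ rearrange (suc y) (2 * T) (ω y) ⟩
      2 * T * (ω y * suc y)          ≡⟨ cong (2 * T *_) (ω-eq y (≤-trans y<T T≤U)) ⟩
      2 * T * L                      ∎
      where
      open ≤-Reasoning
      rearrange : ∀ Y T ω → Y * (T * ω) ≡ T * (ω * Y)
      rearrange = solve-∀
      g h : ℕ → ℕ
      g j = ω (suc y + j) * N (suc y + j)
      h j = 2 * T * ω (y + j)
      rearrange₁ : ∀ i ω N T → i * (ω * N + T * ω) ≡ ω * (N * i) + ω * (T * i)
      rearrange₁ = solve-∀
      rearrange₂ : ∀ i ω T → ω * T + ω * (T * i) ≡ T * (ω * suc i)
      rearrange₂ = solve-∀
      rearrange₃ : ∀ i ω T → T * (ω * i) ≡ i * (T * ω)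
      rearrange₃ = solve-∀
      step : ∀ j → j < T ∸ suc y → g j + h (suc j) ≤ h j
      step j j<T-Y = subst (λ i → g j + 2 * T * ω i ≤ h j) (sym (+-suc y j)) (*-cancelˡ-≤ i (begin
        i * (ω i * N i + 2 * T * ω i)        ≡⟨ rearrange₁ i (ω i) (N i) (2 * T) ⟩
        ω i * (N i * i) + ω i * (2 * T * i)  ≤⟨ +-monoˡ-≤ (ω i * (2 * T * i)) (*-monoʳ-≤ (ω i) (N-medium i i<T)) ⟩
        ω i * (2 * T) + ω i * (2 * T * i)    ≡⟨ rearrange₂ i (ω i) (2 * T) ⟩
        2 * T * (ω i * suc i)                ≡⟨ cong (2 * T *_) (trans (ω-eq i (≤-trans i<T T≤U))
                                                  (sym (ω-eq (y + j) (≤-trans (<⇒≤ i<T) T≤U)))) ⟩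
        2 * T * (ω (y + j) * i)              ≡⟨ rearrange₃ i (ω (y + j)) (2 * T) ⟩
        i * (2 * T * ω (y + j))              ∎))
        where
        i = suc y + j
        i<T : i < T
        i<T = ≤-trans (+-monoʳ-< (suc y) j<T-Y) (≤-reflexive (m+[n∸m]≡n y<T))

    -- Each of the fewer than U numbers e > T divides at most one term, and has
    -- weight at most L / T.
    large : ∑ (U ∸ T) (λ j → ω (T + j) * N (T + j)) ≤ (A + B) * L
    large = *-cancelˡ-≤ T {{>-nonZero (≤-trans z<s y<T)}} (begin
      T * ∑ (U ∸ T) g           ≡⟨ *-distribˡ-∑ T (U ∸ T) g ⟩
      ∑ (U ∸ T) (λ j → T * g j) ≤⟨ ∑-mono (U ∸ T) term ⟩
      ∑ (U ∸ T) (λ j → L)       ≡⟨ ∑-const (U ∸ T) L ⟩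
      (U ∸ T) * L               ≤⟨ *-monoˡ-≤ L (m∸n≤m U T) ⟩
      (A + B) * T * L           ≡⟨ rearrange (A + B) T L ⟩
      T * ((A + B) * L)         ∎)
      where
      open ≤-Reasoning
      rearrange : ∀ C T L → C * T * L ≡ T * (C * L)
      rearrange = solve-∀
      g : ℕ → ℕ
      g j = ω (T + j) * N (T + j)
      term : ∀ j → j < U ∸ T → T * g j ≤ L
      term j j<U-T = begin
        T * (ω i * N i)         ≤⟨ *-mono-≤ (≤-trans (m≤m+n T j) (n≤1+n i)) (*-monoʳ-≤ (ω i) (N-large i (m≤m+n T j))) ⟩
        suc i * (ω i * 1)       ≡⟨ trans (cong (suc i *_) (*-identityʳ (ω i))) (*-comm (suc i) (ω i)) ⟩
        ω i * suc i             ≡⟨ ω-eq i (≤-trans (+-monoʳ-< T j<U-T) (≤-reflexive (m+[n∸m]≡n T≤U))) ⟩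
        L                       ∎
        where i = T + j

    -- No e ≤ y + 1 contributes.
    total : suc y * ∑ U (λ i → ω i * N i) ≤ 2 * T * L + suc y * ((A + B) * L)
    total = begin
      suc y * ∑ U f                                       ≡⟨ cong (suc y *_) split ⟩
      suc y * (∑ (T ∸ suc y) (λ j → f (suc y + j)) + ∑ (U ∸ T) (λ j → f (T + j)))
                                                          ≡⟨ *-distribˡ-+ (suc y) (∑ (T ∸ suc y) (λ j → f (suc y + j))) _ ⟩
      suc y * ∑ (T ∸ suc y) (λ j → f (suc y + j)) + suc y * ∑ (U ∸ T) (λ j → f (T + j))
                                                          ≤⟨ +-mono-≤ medium (*-monoʳ-≤ (suc y) large) ⟩
      2 * T * L + suc y * ((A + B) * L)                   ∎
      where
      open ≤-Reasoning
      f : ℕ → ℕ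
      f i = ω i * N i
      small : ∑ (suc y) f ≡ 0
      small = trans (∑-cong (suc y) λ i i<Y → trans (cong (ω i *_) (N-small i i<Y)) (*-zeroʳ (ω i)))
                    (trans (∑-const (suc y) 0) (*-zeroʳ (suc y)))
      split : ∑ U f ≡ ∑ (T ∸ suc y) (λ j → f (suc y + j)) + ∑ (U ∸ T) (λ j → f (T + j))
      split = trans (cong (λ l → ∑ l f) (sym (m+[n∸m]≡n T≤U))) (trans (∑-++ T (U ∸ T) f)
        (cong (_+ ∑ (U ∸ T) (λ j → f (T + j)))
          (trans (cong (λ l → ∑ l f) (sym (m+[n∸m]≡n y<T))) (trans (∑-++ (suc y) (T ∸ suc y) f)
            (cong (_+ ∑ (T ∸ suc y) (λ j → f (suc y + j))) small)))))

    -- The terms that fail the bound u ≤ 2 P φ(u).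
    bad? : ∀ t → Dec (2 * (P * φ (u t)) < u t)
    bad? t = 2 * (P * φ (u t)) <? u t

    -- The sum of L / e over the rough divisors e of u t.
    S : ℕ → ℕ
    S t = ∑ U (λ i → [ roughDivisor? P (u t) (suc i) ] * ω i)

    bad⇒heavy : ∀ t → t < T → L * [ bad? t ] ≤ 2 * S t
    bad⇒heavy t t<T = cases (bad? t)
      where
      open ≤-Reasoning
      v = u t
      0<v : 0 < v
      0<v = ≤-trans 0<B (m≤n+m B (A * t))
      v≤U : v ≤ U
      v≤U = begin
        A * t + B        ≤⟨ +-mono-≤ (*-monoʳ-≤ A (<⇒≤ t<T)) (m≤m*n B T {{>-nonZero (≤-trans z<s y<T)}}) ⟩
        A * T + B * T    ≡⟨ *-distribʳ-+ T A B ⟨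
        (A + B) * T      ∎
      rearrange₁ : ∀ L p s v → 2 * (L * p + v * s) ≡ L * (2 * p) + v * (2 * s)
      rearrange₁ = solve-∀
      heavy : 2 * (P * φ v) < v → L ≤ 2 * S t
      heavy bad with L ≤? 2 * S t
      ... | yes L≤2S = L≤2S
      ... | no  L≰2S = ⊥-elim (<-irrefl refl (begin-strict
        L * v + L * v                         ≡⟨ cong (L * v +_) (+-identityʳ (L * v)) ⟨
        2 * (L * v)                           ≤⟨ *-monoʳ-≤ 2 (φ-lower ω ω-eq 0<P 0<v v≤U) ⟩
        2 * (L * (P * φ v) + v * S t)         ≡⟨ rearrange₁ L (P * φ v) (S t) v ⟩
        L * (2 * (P * φ v)) + v * (2 * S t)   ≤⟨ +-monoˡ-≤ (v * (2 * S t)) (*-monoʳ-≤ L (<⇒≤ bad)) ⟩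
        L * v + v * (2 * S t)                 <⟨ +-monoʳ-< (L * v) (*-monoʳ-< v {{>-nonZero 0<v}} (≰⇒> L≰2S)) ⟩
        L * v + v * L                         ≡⟨ cong (L * v +_) (*-comm v L) ⟩
        L * v + L * v                         ∎))
      cases : (d : Dec (2 * (P * φ v) < v)) → L * [ d ] ≤ 2 * S t
      cases (yes bad) = ≤-trans (≤-reflexive (*-identityʳ L)) (heavy bad)
      cases (no  _)   = ≤-trans (≤-reflexive (*-zeroʳ L)) z≤n

    few-bad : suc y * ∑ T (λ t → [ bad? t ]) ≤ 4 * T + 2 * suc y * (A + B)
    few-bad = *-cancelˡ-≤ L {{>-nonZero (0<∏ U λ _ _ → z<s)}} (begin
      L * (suc y * ∑ T b)                              ≡⟨ rearrange₁ L (suc y) (∑ T b) ⟩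
      suc y * (L * ∑ T b)                              ≡⟨ cong (suc y *_) (*-distribˡ-∑ L T b) ⟩
      suc y * ∑ T (λ t → L * b t)                      ≤⟨ *-monoʳ-≤ (suc y) (∑-mono T bad⇒heavy) ⟩
      suc y * ∑ T (λ t → 2 * S t)                      ≡⟨ cong (suc y *_) (*-distribˡ-∑ 2 T S) ⟨
      suc y * (2 * ∑ T S)                              ≡⟨ rearrange₂ (suc y) (∑ T S) ⟩
      2 * (suc y * ∑ T S)                              ≡⟨ cong (λ s → 2 * (suc y * s)) ∑S≡ ⟩
      2 * (suc y * ∑ U (λ i → ω i * N i))              ≤⟨ *-monoʳ-≤ 2 total ⟩
      2 * (2 * T * L + suc y * ((A + B) * L))          ≡⟨ rearrange₃ T L (suc y) (A + B) ⟩
      L * (4 * T + 2 * suc y * (A + B))                ∎)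
      where
      open ≤-Reasoning
      b : ℕ → ℕ
      b t = [ bad? t ]
      rearrange₁ : ∀ L Y b → L * (Y * b) ≡ Y * (L * b)
      rearrange₁ = solve-∀
      rearrange₂ : ∀ Y s → Y * (2 * s) ≡ 2 * (Y * s)
      rearrange₂ = solve-∀
      rearrange₃ : ∀ T L Y C → 2 * (2 * T * L + Y * (C * L)) ≡ L * (4 * T + 2 * Y * C)
      rearrange₃ = solve-∀
      ∑S≡ : ∑ T S ≡ ∑ U (λ i → ω i * N i)
      ∑S≡ = trans (∑-swap T U (λ t i → [ roughDivisor? P (u t) (suc i) ] * ω i))
        (∑-cong U λ i _ → trans (sym (*-distribʳ-∑ (ω i) T (λ t → [ roughDivisor? P (u t) (suc i) ])))
                                (*-comm (N i) (ω i)))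

  -- Construction of the progression

  -- A linear congruence A t + B ≡ 0 modulo Q with Q coprime to A is solvable.
  -- Bézout's identity gives y with A y ≡ -1 or A y ≡ 1.  In the second case y is
  -- multiplied by the modulus minus 1 to change the sign.
  solve-congruence : ∀ {Q A} → 0 < Q → Coprime Q A → ∀ B → ∃[ t ] Q ∣ A * t + B
  solve-congruence {suc Q} {A} _ Q⊥A B with Coprimality.coprime-Bézout Q⊥A
  ... | Bézout.+- x y eq = y * B , divides (x * B) (trans (rearrange A y B)
          (trans (cong (_* B) eq) (swap x (suc Q) B)))
    where
    rearrange : ∀ A y B → A * (y * B) + B ≡ (1 + y * A) * B
    rearrange = solve-∀
    swap : ∀ x Q B → x * Q * B ≡ x * B * Q
    swap = solve-∀
  ... | Bézout.-+ x y eq = y * (Q * B) , divides (x * (Q * B) + B) (trans (rearrange₁ A y Q B)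
          (trans (cong (λ l → l * (Q * B) + B) (sym eq)) (rearrange₂ x Q B)))
    where
    rearrange₁ : ∀ A y Q B → A * (y * (Q * B)) + B ≡ y * A * (Q * B) + B
    rearrange₁ = solve-∀
    rearrange₂ : ∀ x Q B → (1 + x * suc Q) * (Q * B) + B ≡ (x * (Q * B) + B) * suc Q
    rearrange₂ = solve-∀

  ∣-∣-∣ : ∀ {e m n} → e ∣ m → e ∣ n → e ∣ ∣ m - n ∣
  ∣-∣-∣ {e} (divides p refl) (divides q refl) = divides ∣ p - q ∣ (sym (*-distribʳ-∣-∣ e p q))

  -- Combines φ(v) / v ≤ φ(Q) / Q with u ≤ 2 P φ(u).
  φ-< : ∀ {K P Q u v} → 0 < v → v ≤ K * u → u ≤ 2 * (P * φ u) → Q ∣ v →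
        φ Q * (2 * P * K) < Q → φ v < φ u
  φ-< {K} {P} {Q} {u} 0<v v≤Ku u≤2Pφu (divides zero    refl) Q-small = contradiction 0<v λ ()
  φ-< {K} {P} {Q} {u} 0<v v≤Ku u≤2Pφu (divides (suc w) refl) Q-small = ≰⇒> λ φu≤φv →
    <-irrefl refl (begin-strict
      suc w * Q                              ≤⟨ v≤Ku ⟩
      K * u                                  ≤⟨ *-monoʳ-≤ K u≤2Pφu ⟩
      K * (2 * (P * φ u))                    ≤⟨ *-monoʳ-≤ K (*-monoʳ-≤ 2 (*-monoʳ-≤ P (≤-trans φu≤φv φv≤))) ⟩
      K * (2 * (P * (suc w * φ Q)))          ≡⟨ rearrange K P (suc w) (φ Q) ⟩
      suc w * (φ Q * (2 * P * K))            <⟨ *-monoʳ-< (suc w) Q-small ⟩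
      suc w * Q                              ∎)
    where
    open ≤-Reasoning
    φv≤ : φ (suc w * Q) ≤ suc w * φ Q
    φv≤ = subst (λ l → φ l ≤ suc w * φ Q) (*-comm Q (suc w)) (φ-*-≤ Q (suc w))
    rearrange : ∀ K P w f → K * (2 * (P * (w * f))) ≡ w * (f * (2 * P * K))
    rearrange = solve-∀

  -- The shifts σ 0, …, σ (k - 1) are treated in this order.  By the hypothesis
  -- apart, c u - a v is a nonzero constant when u = a (n + σ i) + b and
  -- v = c (n + σ j) + d with j not treated before i.
  module Construction
    {a b c d k : ℕ} (0<a : 0 < a) (0<b : 0 < b) (0<c : 0 < c) (0<d : 0 < d) (0<k : 0 < k)
    (σ : ℕ → ℕ)
    (apart : ∀ {i j} → i ≤ j → c * (a * σ i + b) ≢ a * (c * σ j + d))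
    where

    -- At most a proportion 4 / (y + 1) of the terms is bad for each of the k
    -- shifts, up to a bounded number; in total this is less than a quarter.
    y : ℕ
    y = 16 * k

    -- The constant value of ∣ c u - a v ∣ for the shifts σ i in u and σ j in v.
    F : ℕ → ℕ → ℕ
    F i j = ∣ c * (a * σ i + b) - a * (c * σ j + d) ∣

    0<F : ∀ {i j} → i ≤ j → 0 < F i j
    0<F i≤j = n≢0⇒n>0 λ F≡0 → apart i≤j (∣m-n∣≡0⇒m≡n F≡0)

    -- The constants that Q j must be coprime to.
    Fs : ℕ → ℕ
    Fs j = ∏ (suc j) (λ i → F i j)

    0<Fs : ∀ j → 0 < Fs j
    0<Fs j = 0<∏ (suc j) λ i i≤j → 0<F (≤-pred i≤j)

    -- A number coprime to sieve-modulus m is coprime to a and m, and it exceeds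
    -- y + 1 unless it is 1.
    sieve-modulus : ℕ → ℕ
    sieve-modulus m = ∏ (suc y) suc * a * m

    0<sieve-modulus : ∀ {m} → 0 < m → 0 < sieve-modulus m
    0<sieve-modulus 0<m = *-mono-≤ (*-mono-≤ (0<∏ (suc y) {suc} λ _ _ → z<s) 0<a) 0<m

    -- The choice of Q for σ j, where m is the product of the earlier Q's.  Opaque,
    -- so that the chosen numbers do not unfold.
    abstract
      pick : ∀ j {m} → 0 < m →
             ∃[ Q ] (0 < Q × Coprime Q (c * m * Fs j) × φ Q * (2 * sieve-modulus m * (c + d)) < Q)
      pick j {m} 0<m = small-φ-ratio (c * m * Fs j) (2 * sieve-modulus m * (c + d))
                                     (*-mono-≤ (*-mono-≤ 0<c 0<m) (0<Fs j))

    -- The product of the first j chosen numbers.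
    product : ℕ → ∃[ m ] 0 < m
    product zero    = 1 , z<s
    product (suc j) with product j
    ... | m , 0<m with pick j 0<m
    ... | Q , 0<Q , _ = m * Q , *-mono-≤ 0<m 0<Q

    -- Q j is the divisor to be forced into c (n + σ j) + d, M j is the product of
    -- the Q i with i < j, and P j is the modulus of the lower bound for
    -- φ (a (n + σ j) + b).
    M Q P : ℕ → ℕ
    M j = proj₁ (product j)
    Q j = proj₁ (pick j (proj₂ (product j)))
    P j = sieve-modulus (M j)

    0<M : ∀ j → 0 < M j
    0<M j = proj₂ (product j)

    0<Q : ∀ j → 0 < Q j
    0<Q j = proj₁ (proj₂ (pick j (0<M j)))

    Q-coprime : ∀ j → Coprime (Q j) (c * M j * Fs j)
    Q-coprime j = proj₁ (proj₂ (proj₂ (pick j (0<M j))))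

    Q-small : ∀ j → φ (Q j) * (2 * P j * (c + d)) < Q j
    Q-small j = proj₂ (proj₂ (proj₂ (pick j (0<M j))))

    0<P : ∀ j → 0 < P j
    0<P j = 0<sieve-modulus (0<M j)

    M-suc : ∀ j → M (suc j) ≡ M j * Q j
    M-suc j = refl

    Q∣M : ∀ {j i} → j < i → Q j ∣ M i
    Q∣M {j} {suc i} j<i with m≤n⇒m<n∨m≡n (≤-pred j<i)
    ... | inj₁ j<i′ = subst (Q j ∣_) (sym (M-suc i)) (∣m⇒∣m*n (Q i) (Q∣M j<i′))
    ... | inj₂ refl = subst (Q j ∣_) (sym (M-suc i)) (n∣m*n (M i))

    -- The Chinese remainder theorem, one modulus at a time.
    residue : ∀ i → ∃[ r ] (∀ {j} → j < i → Q j ∣ c * (r + σ j) + d)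
    residue zero    = 0 , λ ()
    residue (suc i) with residue i
    ... | r , Q∣v with solve-congruence {A = c * M i} (0<Q i) (coprime-∣ ∣-refl (m∣m*n (Fs i)) (Q-coprime i)) (c * (r + σ i) + d)
    ... | t , Qi∣ = r + M i * t , step
      where
      rearrange : ∀ c M t r s d → c * M * t + (c * (r + s) + d) ≡ c * (r + M * t + s) + d
      rearrange = solve-∀
      step : ∀ {j} → j < suc i → Q j ∣ c * (r + M i * t + σ j) + d
      step {j} j≤i with m≤n⇒m<n∨m≡n (≤-pred j≤i)
      ... | inj₁ j<i  = subst (Q j ∣_) (rearrange c (M i) t r (σ j) d)
                          (∣m∣n⇒∣m+n (∣m⇒∣m*n t (∣n⇒∣m*n c (Q∣M j<i))) (Q∣v j<i))
      ... | inj₂ refl = subst (Q j ∣_) (rearrange c (M i) t r (σ j) d) Qi∣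

    -- The progression is n[ t ] = R + t M k, along which a (n + σ i) + b is
    -- A t + B i.
    R A : ℕ
    R = proj₁ (residue k)
    A = a * M k

    B : ℕ → ℕ
    B i = a * (R + σ i) + b

    n[_] : ℕ → ℕ
    n[ t ] = R + t * M k

    u-eq : ∀ i t → A * t + B i ≡ a * (n[ t ] + σ i) + b
    u-eq i t = rearrange a (M k) t R (σ i) b
      where
      rearrange : ∀ a M t R s b → a * M * t + (a * (R + s) + b) ≡ a * (R + t * M + s) + b
      rearrange = solve-∀

    Q∣v : ∀ {j} t → j < k → Q j ∣ c * (n[ t ] + σ j) + d
    Q∣v {j} t j<k = subst (Q j ∣_) (rearrange c (M k) t R (σ j) d)
      (∣m∣n⇒∣m+n (∣n⇒∣m*n (c * t) (Q∣M j<k)) (proj₂ (residue k) j<k))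
      where
      rearrange : ∀ c M t R s d → c * t * M + (c * (R + s) + d) ≡ c * (R + t * M + s) + d
      rearrange = solve-∀

    difference : ∀ n i j → ∣ c * (a * (n + σ i) + b) - a * (c * (n + σ j) + d) ∣ ≡ F i j
    difference n i j = trans (cong₂ ∣_-_∣ (rearrange₁ a b c n (σ i)) (rearrange₂ a c d n (σ j)))
                             (∣m+n-m+o∣≡∣n-o∣ (a * c * n) _ _)
      where
      rearrange₁ : ∀ a b c n s → c * (a * (n + s) + b) ≡ a * c * n + c * (a * s + b)
      rearrange₁ = solve-∀
      rearrange₂ : ∀ a c d n s → a * (c * (n + s) + d) ≡ a * c * n + a * (c * s + d)
      rearrange₂ = solve-∀

    rough⇒large : ∀ {e} i → 1 < e → Coprime e (P i) → suc y < e
    rough⇒large {suc e} i 1<e e⊥P = ≰⇒> λ e<Y → <-irrefl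
      (sym (e⊥P (∣-refl , ∣m⇒∣m*n (M i) (∣m⇒∣m*n a (∣∏ (suc y) suc e<Y))))) 1<e

    rough⇒⊥A : ∀ {e} i t → e ∣ A * t + B i → Coprime e (P i) → Coprime e A
    rough⇒⊥A {e} i t e∣u e⊥P = coprime-* (coprime-∣ ∣-refl a∣P e⊥P) (e⊥M k ≤-refl)
      where
      a∣P : a ∣ P i
      a∣P = ∣m⇒∣m*n (M i) (n∣m*n (∏ (suc y) suc))
      -- A common divisor of e and Q j divides both u and v, hence F i j.
      e⊥later : ∀ j → i ≤ j → j < k → Coprime e (Q j)
      e⊥later j i≤j j<k {g} (g∣e , g∣Q) = Q-coprime j (g∣Q , ∣n⇒∣m*n (c * M j) (∣-trans
        (subst (g ∣_) (difference n[ t ] i j) (∣-∣-∣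
          (∣n⇒∣m*n c (subst (g ∣_) (u-eq i t) (∣-trans g∣e e∣u)))
          (∣n⇒∣m*n a (∣-trans g∣Q (Q∣v t j<k)))))
        (∣∏ (suc j) (λ i → F i j) (s≤s i≤j))))
      e⊥Q : ∀ j → j < k → Coprime e (Q j)
      e⊥Q j j<k with j <? i
      ... | yes j<i = coprime-∣ ∣-refl (∣n⇒∣m*n (∏ (suc y) suc * a) (Q∣M j<i)) e⊥P
      ... | no  j≮i = e⊥later j (≮⇒≥ j≮i) j<k
      e⊥M : ∀ j → j ≤ k → Coprime e (M j)
      e⊥M zero    _   (_ , g∣1) = ∣1⇒≡1 g∣1
      e⊥M (suc j) j<k = subst (Coprime e) (sym (M-suc j)) (coprime-* (e⊥M j (<⇒≤ j<k)) (e⊥Q j j<k))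

    0<A : 0 < A
    0<A = *-mono-≤ 0<a (0<M k)

    0<B : ∀ i → 0 < B i
    0<B i = ≤-trans 0<b (m≤n+m b (a * (R + σ i)))

    bad? : ∀ i t → Dec (2 * (P i * φ (A * t + B i)) < A * t + B i)
    bad? i t = 2 * (P i * φ (A * t + B i)) <? A * t + B i

    few-bad : ∀ i T → y < T → suc y * ∑ T (λ t → [ bad? i t ]) ≤ 4 * T + 2 * suc y * (A + B i)
    few-bad i T y<T = Average.few-bad 0<A (0<B i) (0<P i) (rough⇒large i) (rough⇒⊥A i) T y<T

    -- From T₀ on, the terms bounded independently of T are negligible.
    T₀ : ℕ
    T₀ = suc y * suc (∑ k (λ i → A + B i))

    few-bad-total : ∀ T → T₀ ≤ T → 2 * ∑ k (λ i → ∑ T (λ t → [ bad? i t ])) ≤ T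
    few-bad-total T T₀≤T = *-cancelˡ-≤ (8 * k) {{m*n≢0 8 k}} (begin
      8 * k * (2 * X)                               ≡⟨ rearrange₁ k X ⟩
      16 * k * X                                    ≤⟨ *-monoˡ-≤ X (n≤1+n y) ⟩
      suc y * X                                     ≡⟨ *-distribˡ-∑ (suc y) k _ ⟩
      ∑ k (λ i → suc y * ∑ T (λ t → [ bad? i t ]))  ≤⟨ ∑-mono k (λ i _ → few-bad i T y<T) ⟩
      ∑ k (λ i → 4 * T + 2 * suc y * (A + B i))     ≡⟨ trans (∑-distrib-+ k (λ _ → 4 * T) _)
                                                         (cong₂ _+_ (∑-const k (4 * T)) (sym (*-distribˡ-∑ (2 * suc y) k (λ i → A + B i)))) ⟩
      k * (4 * T) + 2 * suc y * D                   ≡⟨ cong (k * (4 * T) +_) (*-assoc 2 (suc y) D) ⟩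
      k * (4 * T) + 2 * (suc y * D)                 ≤⟨ +-monoʳ-≤ (k * (4 * T)) (*-monoʳ-≤ 2 YD≤kT) ⟩
      k * (4 * T) + 2 * (k * T)                     ≤⟨ m≤m+n _ (2 * (k * T)) ⟩
      k * (4 * T) + 2 * (k * T) + 2 * (k * T)       ≡⟨ rearrange₂ k T ⟩
      8 * k * T                                     ∎)
      where
      open ≤-Reasoning
      instance
        _ : NonZero k
        _ = >-nonZero 0<k
      D X : ℕ
      D = ∑ k (λ i → A + B i)
      X = ∑ k (λ i → ∑ T (λ t → [ bad? i t ]))
      rearrange₁ : ∀ k X → 8 * k * (2 * X) ≡ 16 * k * X
      rearrange₁ = solve-∀
      rearrange₂ : ∀ k T → k * (4 * T) + 2 * (k * T) + 2 * (k * T) ≡ 8 * k * T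
      rearrange₂ = solve-∀
      y<T : y < T
      y<T = ≤-trans (m≤m*n (suc y) (suc D)) T₀≤T
      YD≤kT : suc y * D ≤ k * T
      YD≤kT = ≤-trans (*-monoʳ-≤ (suc y) (n≤1+n D)) (≤-trans T₀≤T (m≤n*m T k))

    -- The factor K = c + d in the choice of Q makes up for v ≤ (c + d) u.
    good : ∀ {i} t → i < k → ¬ (2 * (P i * φ (A * t + B i)) < A * t + B i) →
           φ (c * (n[ t ] + σ i) + d) < φ (a * (n[ t ] + σ i) + b)
    good {i} t i<k ¬bad = φ-< {c + d} {P i} {Q i} {u} {v} (≤-trans 0<d (m≤n+m d (c * (n[ t ] + σ i)))) v≤Ku
      (subst (λ l → l ≤ 2 * (P i * φ l)) (u-eq i t) (≮⇒≥ ¬bad)) (Q∣v t i<k) (Q-small i)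
      where
      open ≤-Reasoning
      m = n[ t ] + σ i
      u = a * m + b
      v = c * m + d
      v≤Ku : v ≤ (c + d) * u
      v≤Ku = begin
        c * m + d                          ≤⟨ +-mono-≤ (*-mono-≤ (m≤m+n c d) (m≤n*m m a {{>-nonZero 0<a}}))
                                                       (≤-trans (m≤n+m d c) (m≤m*n (c + d) b {{>-nonZero 0<b}})) ⟩
        (c + d) * (a * m) + (c + d) * b    ≡⟨ *-distribˡ-+ (c + d) (a * m) b ⟨
        (c + d) * u                        ∎

    -- Every t is bad for some i or else gives a run.
    many-good : {G : ℕ → Set} (G? : ∀ n → Dec (G n)) →
                (∀ n → (∀ i → i < k → φ (c * (n + σ i) + d) < φ (a * (n + σ i) + b)) → G n) →
                ∀ T → T₀ ≤ T → T ≤ 2 * ∑ T (λ t → [ G? n[ t ] ])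
    many-good G? G-intro T T₀≤T = +-cancelˡ-≤ T T (2 * Y) (begin
      T + T                                        ≡⟨ cong (T +_) (+-identityʳ T) ⟨
      2 * T                                        ≡⟨ cong (2 *_) (trans (∑-const T 1) (*-identityʳ T)) ⟨
      2 * ∑ T (λ _ → 1)                            ≤⟨ *-monoʳ-≤ 2 (∑-mono T (λ t _ → pointwise t)) ⟩
      2 * ∑ T (λ t → ∑ k (λ i → [ bad? i t ]) + [ G? n[ t ] ])
        ≡⟨ cong (2 *_) (trans (∑-distrib-+ T (λ t → ∑ k (λ i → [ bad? i t ])) _)
                              (cong (_+ Y) (∑-swap T k (λ t i → [ bad? i t ])))) ⟩
      2 * (∑ k (λ i → ∑ T (λ t → [ bad? i t ])) + Y)
        ≡⟨ *-distribˡ-+ 2 (∑ k (λ i → ∑ T (λ t → [ bad? i t ]))) Y ⟩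
      2 * ∑ k (λ i → ∑ T (λ t → [ bad? i t ])) + 2 * Y
        ≤⟨ +-monoˡ-≤ (2 * Y) (few-bad-total T T₀≤T) ⟩
      T + 2 * Y                                    ∎)
      where
      open ≤-Reasoning
      Y = ∑ T (λ t → [ G? n[ t ] ])
      pointwise : ∀ t → 1 ≤ ∑ k (λ i → [ bad? i t ]) + [ G? n[ t ] ]
      pointwise t with ∑ k (λ i → [ bad? i t ]) in eq
      ... | suc _ = s≤s z≤n
      ... | zero  = ≤-reflexive (sym ([]-true (G? n[ t ]) (G-intro n[ t ] λ i i<k → good t i<k (¬bad i i<k))))
        where
        ¬bad : ∀ i → i < k → ¬ (2 * (P i * φ (A * t + B i)) < A * t + B i)
        ¬bad i i<k bad = <⇒≱ {0} {1} z<s (begin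
          1                         ≡⟨ []-true (bad? i t) bad ⟨
          [ bad? i t ]              ≤⟨ term≤∑ k (λ i → [ bad? i t ]) i<k ⟩
          ∑ k (λ i → [ bad? i t ])  ≡⟨ eq ⟩
          0                         ∎)

  -- Positive lower density

  1/-≤-/ : ∀ C m n → suc n ≤ suc C * m → ℤ.+ 1 ℚ./ suc C ℚ.≤ ℤ.+ m ℚ./ suc n
  1/-≤-/ C m n n≤Cm = ℚ.toℚᵘ-cancel-≤ (begin
    ℚ.toℚᵘ (ℤ.+ 1 ℚ./ suc C)   ≃⟨ ℚ.toℚᵘ-fromℚᵘ (ℚᵘ.mkℚᵘ (ℤ.+ 1) C) ⟩
    ℚᵘ.mkℚᵘ (ℤ.+ 1) C          ≤⟨ ℚᵘ.*≤* (subst₂ ℤ._≤_ (ℤ.pos-* 1 (suc n)) (ℤ.pos-* m (suc C))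
                                  (ℤ.+≤+ (subst₂ _≤_ (sym (*-identityˡ (suc n))) (*-comm (suc C) m) n≤Cm))) ⟩
    ℚᵘ.mkℚᵘ (ℤ.+ m) n          ≃⟨ ℚ.toℚᵘ-fromℚᵘ (ℚᵘ.mkℚᵘ (ℤ.+ m) n) ⟨
    ℚ.toℚᵘ (ℤ.+ m ℚ./ suc n)   ∎)
    where open ℚᵘ.≤-Reasoning

  -- If count P? x ≥ x / (C + 1) for large x, then 1 / (C + 1) witnesses positive
  -- lower density.
  linear⇒positive-density : {P : Pred ℕ 0ℓ} (P? : Decidable P) (C N : ℕ) →
    (∀ x → N ≤ x → x ≤ suc C * count P? x) → HasPositiveLowerDensity P P?
  linear⇒positive-density P? C N linear =
    ℤ.+ 1 ℚ./ suc C ,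
    ℚ.positive⁻¹ (ℤ.+ 1 ℚ./ suc C) {{ℚ.normalize-pos 1 (suc C)}} ,
    N , λ n N≤n → 1/-≤-/ C (count P? (suc n)) n (linear (suc n) (≤-trans N≤n (n≤1+n n)))

  -- It is enough that P holds for half of the first T terms of a progression, for
  -- every large T.  The first T = ⌊(x - s) / M⌋ terms are at most x, which gives
  -- the proportion 1 / 4M for large x.  The progression starts at s + 1, as counting
  -- starts at 1.
  progression⇒positive-density : {P : Pred ℕ 0ℓ} (P? : Decidable P) (s M T₀ : ℕ) → 0 < M →
    (∀ T → T₀ ≤ T → T ≤ 2 * ∑ T (λ t → [ P? (suc (s + t * M)) ])) → HasPositiveLowerDensity P P?
  progression⇒positive-density P? s (suc M′) T₀ _ half = linear⇒positive-density P? (pred (4 * M)) N λ x N≤x →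
    let
      T = (x ∸ s) / M
      X = count P? x
      s≤x : s ≤ x
      s≤x = ≤-trans (≤-trans (m≤m+n s M) (≤-trans (m≤m+n (s + M) _) (m≤m+n (2 * (s + M)) _))) N≤x
      s+TM≤x : s + T * M ≤ x
      s+TM≤x = ≤-trans (+-monoʳ-≤ s (m/n*n≤m (x ∸ s) M)) (≤-reflexive (m+[n∸m]≡n s≤x))
      T₀M≤x∸s : T₀ * M ≤ x ∸ s
      T₀M≤x∸s = ≤-trans (≤-reflexive (sym (m+n∸m≡n s (T₀ * M)))) (∸-monoˡ-≤ s (≤-trans
        (+-monoˡ-≤ (T₀ * M) (≤-trans (m≤m+n s M) (m≤m+n (s + M) _))) N≤x))
      T₀≤T : T₀ ≤ T
      T₀≤T = ≤-trans (≤-reflexive (sym (m*n/n≡m T₀ M))) (/-mono-≤ T₀M≤x∸s (≤-refl {M}))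
      x≤ : x ≤ s + M + T * M
      x≤ = begin
        x                      ≡⟨ m+[n∸m]≡n s≤x ⟨
        s + (x ∸ s)            ≡⟨ cong (s +_) (m≡m%n+[m/n]*n (x ∸ s) M) ⟩
        s + ((x ∸ s) % M + T * M)  ≤⟨ +-monoʳ-≤ s (+-monoˡ-≤ (T * M) (m%n≤n (x ∸ s) M)) ⟩
        s + (M + T * M)        ≡⟨ +-assoc s M (T * M) ⟨
        s + M + T * M          ∎
      sampled : ∑ T (λ t → [ P? (suc (s + t * M)) ]) ≤ X
      sampled = begin
        ∑ T (λ t → [ P? (suc (s + t * M)) ])        ≡⟨ ∑-cong T (λ t _ → cong (λ l → [ P? (suc (s + l)) ]) (+-identityʳ (t * M))) ⟨
        ∑ T (λ t → [ P? (suc (s + (t * M + 0))) ])  ≤⟨ ∑-sample T M (λ i → [ P? (suc (s + i)) ]) z<s ⟩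
        ∑ (T * M) (λ i → [ P? (suc (s + i)) ])      ≤⟨ m≤n+m _ (∑ s (λ i → [ P? (suc i) ])) ⟩
        ∑ s (λ i → [ P? (suc i) ]) + ∑ (T * M) (λ i → [ P? (suc (s + i)) ]) ≡⟨ ∑-++ s (T * M) (λ i → [ P? (suc i) ]) ⟨
        ∑ (s + T * M) (λ i → [ P? (suc i) ])        ≤⟨ ∑-mono-length (λ i → [ P? (suc i) ]) s+TM≤x ⟩
        ∑ x (λ i → [ P? (suc i) ])                  ≡⟨ count≡∑ P? x ⟨
        X                                           ∎
    in +-cancelˡ-≤ x x (4 * M * X) (begin
      x + x                                   ≤⟨ +-mono-≤ x≤ x≤ ⟩
      (s + M + T * M) + (s + M + T * M)       ≡⟨ rearrange₁ s M T ⟩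
      2 * (s + M) + 2 * (T * M)               ≤⟨ +-mono-≤ (≤-trans (m≤m+n (2 * (s + M)) (T₀ * M)) N≤x)
                                                   (*-monoʳ-≤ 2 (*-monoˡ-≤ M (≤-trans (half T T₀≤T) (*-monoʳ-≤ 2 sampled)))) ⟩
      x + 2 * (2 * X * M)                     ≡⟨ cong (x +_) (rearrange₂ X M) ⟩
      x + 4 * M * X                           ∎)
    where
    open ≤-Reasoning
    M N : ℕ
    M = suc M′
    N = 2 * (s + M) + T₀ * M
    rearrange₁ : ∀ s M T → (s + M + T * M) + (s + M + T * M) ≡ 2 * (s + M) + 2 * (T * M)
    rearrange₁ = solve-∀
    rearrange₂ : ∀ X M → 2 * (2 * X * M) ≡ 4 * M * X
    rearrange₂ = solve-∀

  -- An enumeration σ 0, …, σ (k - 1) of the shifts 1, …, k that satisfies the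
  -- hypothesis apart of the construction.  The values of σ from k on only serve
  -- to make that hypothesis hold for all indices.
  record Order (a b c d k : ℕ) : Set where
    field
      σ     : ℕ → ℕ
      apart : ∀ {i j} → i ≤ j → c * (a * σ i + b) ≢ a * (c * σ j + d)
      onto  : ∀ s → s < k → ∃[ i ] (i < k × σ i ≡ suc s)

  -- In c u - a v = a c (σ i - σ j) + (c b - a d) the first summand must not have the
  -- sign opposite to that of the second for i ≤ j: the shifts ascend if
  -- c b < a d and descend if c b > a d.  Truncated subtraction keeps k ∸ i
  -- weakly descending beyond i = k.
  order : ∀ a b c d k → c * b ≢ a * d → Order a b c d k
  order a b c d k cb≢ad = by-sign (<-cmp (c * b) (a * d))
    where
    rearrange₁ : ∀ a b c s → c * (a * s + b) ≡ a * c * s + c * b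
    rearrange₁ = solve-∀
    rearrange₂ : ∀ a c d s → a * (c * s + d) ≡ a * c * s + a * d
    rearrange₂ = solve-∀
    by-sign : Tri (c * b < a * d) (c * b ≡ a * d) (a * d < c * b) → Order a b c d k
    by-sign (tri≈ _ cb≡ad _) = contradiction cb≡ad cb≢ad
    by-sign (tri< cb<ad _ _) = record
      { σ     = suc
      ; apart = λ {i} {j} i≤j → <⇒≢ (subst₂ _<_ (sym (rearrange₁ a b c (suc i))) (sym (rearrange₂ a c d (suc j)))
                  (+-mono-≤-< (*-monoʳ-≤ (a * c) (s≤s i≤j)) cb<ad))
      ; onto  = λ s s<k → s , s<k , refl
      }
    by-sign (tri> _ _ ad<cb) = record
      { σ     = λ i → k ∸ i
      ; apart = λ {i} {j} i≤j → >⇒≢ (subst₂ _<_ (sym (rearrange₂ a c d (k ∸ j))) (sym (rearrange₁ a b c (k ∸ i)))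
                  (+-mono-≤-< (*-monoʳ-≤ (a * c) (∸-monoʳ-≤ k i≤j)) ad<cb))
      ; onto  = λ s s<k → k ∸ suc s , ∸-monoʳ-< z<s s<k , m∸[m∸n]≡n s<k
      }

  -- The theorem for positive natural coefficients, stated for any P that contains
  -- 1 + n₀ + n whenever n begins a run.
  run⇒positive-density :
    ∀ {a b c d k} → 0 < a → 0 < b → 0 < c → 0 < d → 0 < k → c * b ≢ a * d →
    {P : Pred ℕ 0ℓ} (P? : Decidable P) (n₀ : ℕ) →
    (∀ n → (∀ s → s < k → φ (c * (n + suc s) + d) < φ (a * (n + suc s) + b)) → P (suc n₀ + n)) →
    HasPositiveLowerDensity P P?
  run⇒positive-density {a} {b} {c} {d} {k} 0<a 0<b 0<c 0<d 0<k cb≢ad {P} P? n₀ P-intro =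
    progression⇒positive-density P? (n₀ + R) (M k) T₀ (0<M k) λ T T₀≤T → ≤-trans
      (many-good (λ n → P? (suc n₀ + n)) (λ n run → P-intro n (reindex n run)) T T₀≤T)
      (≤-reflexive (cong (2 *_) (∑-cong T λ t _ → cong (λ l → [ P? (suc l) ]) (sym (+-assoc n₀ R (t * M k))))))
    where
    open Order (order a b c d k cb≢ad)
    open Construction 0<a 0<b 0<c 0<d 0<k σ apart
    reindex : ∀ n → (∀ i → i < k → φ (c * (n + σ i) + d) < φ (a * (n + σ i) + b)) →
              ∀ s → s < k → φ (c * (n + suc s) + d) < φ (a * (n + suc s) + b)
    reindex n run s s<k with onto s s<k
    ... | i , i<k , σi≡1+s = subst (λ s → φ (c * (n + s) + d) < φ (a * (n + s) + b)) σi≡1+s (run i i<k)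

-- Passage from integer to natural coefficients

module _ where
  import Algebra.Properties.AbelianGroup
  open import Data.Fin.Base using (toℕ)
  open import Data.Fin.Properties using (toℕ<n)
  open import Data.Integer.Base as ℤ using (+_; -[1+_]; ∣_∣)
  import Data.Integer.Properties as ℤ
  import Data.Integer.Tactic.RingSolver as ℤ-Solver
  open import Data.Nat.Base using (ℕ; suc; _+_; _*_; _∸_; _<_; z<s; >-nonZero)
  open import Data.Nat.Properties
  open import Data.Product.Base using (_×_; _,_; ∃-syntax)
  open import Relation.Binary.PropositionalEquality using (_≡_; _≢_; refl; sym; trans; cong; cong₂; module ≡-Reasoning)

  private
    module ℤ-Group = Algebra.Properties.AbelianGroup ℤ.+-0-abelianGroup

  shift-positive : ∀ {a n} b → 0 < a → ∣ b ∣ < n → ∃[ b′ ] (0 < b′ × + a ℤ.* + n ℤ.+ b ≡ + b′)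
  shift-positive {suc a} {suc n} (+ b) _ _ =
    suc a * suc n + b , z<s , cong (ℤ._+ + b) (sym (ℤ.pos-* (suc a) (suc n)))
  shift-positive {a} {n} (-[1+ b ]) 0<a b<n = a * n ∸ suc b , m<n⇒0<n∸m b<an ,
    trans (cong (ℤ._+ -[1+ b ]) (sym (ℤ.pos-* a n))) (ℤ.⊖-≥ (<⇒≤ b<an))
    where
    b<an : suc b < a * n
    b<an = ≤-trans b<n (m≤n*m n a {{>-nonZero 0<a}})

  affine-shift : ∀ a b′ n₀ n s b → + a ℤ.* + n₀ ℤ.+ b ≡ + b′ →
                 + a ℤ.* + (n₀ + n + s) ℤ.+ b ≡ + (a * (n + s) + b′)
  affine-shift a b′ n₀ n s b eq = begin
    + a ℤ.* (+ n₀ ℤ.+ + n ℤ.+ + s) ℤ.+ b                ≡⟨ rearrange (+ a) (+ n₀) (+ n) (+ s) b ⟩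
    + a ℤ.* (+ n ℤ.+ + s) ℤ.+ (+ a ℤ.* + n₀ ℤ.+ b)      ≡⟨ cong₂ ℤ._+_ (sym (ℤ.pos-* a (n + s))) eq ⟩
    + (a * (n + s) + b′)                                ∎
    where
    open ≡-Reasoning
    rearrange : ∀ a n₀ n s b → a ℤ.* (n₀ ℤ.+ n ℤ.+ s) ℤ.+ b ≡ a ℤ.* (n ℤ.+ s) ℤ.+ (a ℤ.* n₀ ℤ.+ b)
    rearrange = ℤ-Solver.solve-∀

  -- Translation of n leaves a d - b c unchanged.
  determinant-shift : ∀ a b c d n₀ b′ d′ → + a ℤ.* + n₀ ℤ.+ b ≡ + b′ → + c ℤ.* + n₀ ℤ.+ d ≡ + d′ →
                      + a ℤ.* d ≢ b ℤ.* + c → c * b′ ≢ a * d′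
  determinant-shift a b c d n₀ b′ d′ b-eq d-eq ad≢bc cb′≡ad′ = ad≢bc (ℤ-Group.∙-cancelʳ (+ a ℤ.* + c ℤ.* + n₀) _ _ (begin
    + a ℤ.* d ℤ.+ + a ℤ.* + c ℤ.* + n₀      ≡⟨ rearrange₁ (+ a) (+ c) d (+ n₀) ⟩
    + a ℤ.* (+ c ℤ.* + n₀ ℤ.+ d)            ≡⟨ cong (+ a ℤ.*_) d-eq ⟩
    + a ℤ.* + d′                            ≡⟨ ℤ.pos-* a d′ ⟨
    + (a * d′)                              ≡⟨ cong +_ cb′≡ad′ ⟨
    + (c * b′)                              ≡⟨ ℤ.pos-* c b′ ⟩
    + c ℤ.* + b′                            ≡⟨ cong (+ c ℤ.*_) b-eq ⟨
    + c ℤ.* (+ a ℤ.* + n₀ ℤ.+ b)            ≡⟨ rearrange₂ (+ a) b (+ c) (+ n₀) ⟩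
    b ℤ.* + c ℤ.+ + a ℤ.* + c ℤ.* + n₀      ∎))
    where
    open ≡-Reasoning
    rearrange₁ : ∀ a c d n → a ℤ.* d ℤ.+ a ℤ.* c ℤ.* n ≡ a ℤ.* (c ℤ.* n ℤ.+ d)
    rearrange₁ = ℤ-Solver.solve-∀
    rearrange₂ : ∀ a b c n → c ℤ.* (a ℤ.* n ℤ.+ b) ≡ b ℤ.* c ℤ.+ a ℤ.* c ℤ.* n
    rearrange₂ = ℤ-Solver.solve-∀

  φ>-intro : ∀ {u v u′ v′} → u ≡ + u′ → v ≡ + v′ → 0 < u′ → 0 < v′ → φ v′ < φ u′ → u φ> v
  φ>-intro refl refl 0<u 0<v φv<φu = ℤ.+<+ 0<u , ℤ.+<+ 0<v , φv<φu

  φ-Run-intro : ∀ {a b c d k n₀ b′ d′} → + a ℤ.* + n₀ ℤ.+ b ≡ + b′ → + c ℤ.* + n₀ ℤ.+ d ≡ + d′ →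
    0 < b′ → 0 < d′ →
    ∀ n → (∀ s → s < k → φ (c * (n + suc s) + d′) < φ (a * (n + suc s) + b′)) →
    φ-Run (+ a) b (+ c) d k (n₀ + n)
  φ-Run-intro {a} {b} {c} {d} {k} {n₀} {b′} {d′} b-eq d-eq 0<b′ 0<d′ n run i =
    φ>-intro {u′ = u} {v′ = v}
      (affine-shift a b′ n₀ n s b b-eq) (affine-shift c d′ n₀ n s d d-eq)
      (≤-trans 0<b′ (m≤n+m b′ (a * (n + s)))) (≤-trans 0<d′ (m≤n+m d′ (c * (n + s)))) (run (toℕ i) (toℕ<n i))
    where
    s u v : ℕ
    s = suc (toℕ i)
    u = a * (n + s) + b′
    v = c * (n + s) + d′

open import Data.Integer.Base using (ℤ; 0ℤ; +_; ∣_∣; +<+; _*_; _<_)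
open import Data.Nat.Base as ℕ using (ℕ; suc)
open import Data.Nat.Properties using (m≤m+n; m≤n+m)
open import Data.Product.Base using (_,_)
open import Relation.Binary.PropositionalEquality using (_≢_)

corollary3 : (a b c d : ℤ) → 0ℤ < a → 0ℤ < c → a * d ≢ b * c →
    (k : ℕ) → 0 ℕ.< k →
    HasPositiveLowerDensity (φ-Run a b c d k) (φ-Run? a b c d k)
corollary3 (+ a) b (+ c) d (+<+ 0<a) (+<+ 0<c) ad≢bc k 0<k =
  let
    -- Translating n by 1 + ∣b∣ + ∣d∣ makes both constant terms positive.
    n₀ = ∣ b ∣ ℕ.+ ∣ d ∣
    b′ , 0<b′ , b-eq = shift-positive {a} {suc n₀} b 0<a (ℕ.s≤s (m≤m+n ∣ b ∣ ∣ d ∣))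
    d′ , 0<d′ , d-eq = shift-positive {c} {suc n₀} d 0<c (ℕ.s≤s (m≤n+m ∣ d ∣ ∣ b ∣))
  in run⇒positive-density 0<a 0<b′ 0<c 0<d′ 0<k
       (determinant-shift a b c d (suc n₀) b′ d′ b-eq d-eq ad≢bc)
       (φ-Run? (+ a) b (+ c) d k) n₀
       (φ-Run-intro {a} {b} {c} {d} {k} {suc n₀} b-eq d-eq 0<b′ 0<d′)
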